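{- Let $(\Lambda,\Pi,\perp,\mathrm{push})$ be a realizability lattice. For all $P,R\in\mathcal P_\bullet(\Pi)$ and $L\subseteq\Lambda$: $L\leadsto_\bullet R\subseteq P$ if and only if $R\subseteq P\ast_\bullet L$.
   Context: A realizability lattice consists of sets $\Lambda$ (terms), $\Pi$ (stacks), a relation $\perp\subseteq\Lambda\times\Pi$ (write $t\perp\pi$) and a map $\mathrm{push}:\Lambda\times\Pi\to\Pi$, written $t\cdot\pi$. For $L\subseteq\Lambda$, $L^\perp=\{\pi:\forall t\in L,\ t\perp\pi\}$; for $P\subseteq\Pi$, ${}^\perp P=\{t:\forall \pi\in P,\ t\perp\pi\}$; $\overline P=({}^\perp P)^\perp$; $\widehat P=\bigcup_{\pi\in P}\overline{\{\pi\}}$; $\mathcal P_\bullet(\Pi)=\{P\subseteq\Pi:\widehat P=P\}$. For $L\subseteq\Lambda$, $P\subseteq\Pi$: $L\leadsto P=\{t\cdot\pi:t\in L,\pi\in P\}$, $L\leadsto_\bullet P=\widehat{L\leadsto P}$, and $P\ast_\bullet L=\{\pi\in\Pi: t\cdot\pi'\in P\text{ for all }t\in L,\ \pi'\in\overline{\{\pi\}}\}$. -}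

module Defs where

open import Level using (Level; _⊔_; suc)
open import Data.Product using (∃; ∃₂; _×_)
open import Relation.Binary.Core using (REL)
open import Relation.Binary.PropositionalEquality using (_≡_)
open import Relation.Unary using (Pred; _∈_; _≐_; ｛_｝)

-- Subsets are predicates; equality of subsets is mutual inclusion _≐_.
record RealizabilityLattice (a b r : Level) : Set (suc (a ⊔ b ⊔ r)) where
  infix  4 _⊥_
  infixr 7 _·_
  infix  9 _^⊥ ⊥^_
  infixr 6 _⇝_ _⇝•_
  infixl 6 _∗•_
  field
    Λ   : Set a
    Π   : Set b
    _⊥_ : REL Λ Π r
    _·_ : Λ → Π → Π

  _^⊥ : ∀ {ℓ} → Pred Λ ℓ → Pred Π (a ⊔ r ⊔ ℓ)
  (L ^⊥) π = ∀ t → t ∈ L → t ⊥ π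

  ⊥^_ : ∀ {ℓ} → Pred Π ℓ → Pred Λ (b ⊔ r ⊔ ℓ)
  (⊥^ P) t = ∀ π → π ∈ P → t ⊥ π

  bar : ∀ {ℓ} → Pred Π ℓ → Pred Π (a ⊔ b ⊔ r ⊔ ℓ)
  bar P = (⊥^ P) ^⊥

  hat : ∀ {ℓ} → Pred Π ℓ → Pred Π (a ⊔ b ⊔ r ⊔ ℓ)
  hat P σ = ∃ λ π → π ∈ P × σ ∈ bar ｛ π ｝

  𝒫• : ∀ {ℓ} → Pred (Pred Π ℓ) (a ⊔ b ⊔ r ⊔ ℓ)
  𝒫• P = hat P ≐ P

  _⇝_ : ∀ {ℓ₁ ℓ₂} → Pred Λ ℓ₁ → Pred Π ℓ₂ → Pred Π (a ⊔ b ⊔ ℓ₁ ⊔ ℓ₂)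
  (L ⇝ P) σ = ∃₂ λ t π → t ∈ L × π ∈ P × σ ≡ t · π

  _⇝•_ : ∀ {ℓ₁ ℓ₂} → Pred Λ ℓ₁ → Pred Π ℓ₂ → Pred Π (a ⊔ b ⊔ r ⊔ ℓ₁ ⊔ ℓ₂)
  L ⇝• P = hat (L ⇝ P)

  _∗•_ : ∀ {ℓ₁ ℓ₂} → Pred Π ℓ₁ → Pred Λ ℓ₂ → Pred Π (a ⊔ b ⊔ r ⊔ ℓ₁ ⊔ ℓ₂)
  (P ∗• L) π = ∀ t π′ → t ∈ L → π′ ∈ bar ｛ π ｝ → t · π′ ∈ P

{-# OPTIONS --safe #-}
module Submission where

open import Defs
open import Level using (Level)
open import Data.Product using (_,_)
open import Function.Bundles using (_⇔_; mk⇔)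
open import Relation.Binary.PropositionalEquality using (refl)
open import Relation.Unary using (Pred; _∈_; _⊆_)

-- Both sides amount to `t · π ∈ P` for all `t ∈ L` and `π ∈ R`. Closure of `P` under `hat` absorbs
-- the `hat` in `L ⇝• R`; closure of `R` absorbs the passage from `π` to `bar ｛ π ｝` in `P ∗• L`.
-- Extensivity of `bar` and `hat` removes the closures again.

module _ {a b r : Level} (𝓡 : RealizabilityLattice a b r) where
  open RealizabilityLattice 𝓡

  ⊆-bar : ∀ {ℓ} (P : Pred Π ℓ) → P ⊆ bar P
  ⊆-bar P {π} π∈P t t∈⊥P = t∈⊥P π π∈P

  ⊆-hat : ∀ {ℓ} (P : Pred Π ℓ) → P ⊆ hat P
  ⊆-hat P {π} π∈P = π , π∈P , ⊆-bar _ refl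

mainTheorem3 : ∀ {a b r p q ℓ : Level} (𝓡 : RealizabilityLattice a b r) →
    let open RealizabilityLattice 𝓡 in
    (P : Pred Π p) (R : Pred Π q) (L : Pred Λ ℓ) →
    P ∈ 𝒫• → R ∈ 𝒫• →
    (L ⇝• R ⊆ P) ⇔ (R ⊆ P ∗• L)
mainTheorem3 𝓡 P R L (hatP⊆P , _) (hatR⊆R , _) = mk⇔
  (λ L⇝•R⊆P {π} π∈R t π′ t∈L π′∈barπ →
    -- `π′` lies in `hat R`, hence in `R`, so `t · π′` is already in `L ⇝ R`.
    L⇝•R⊆P (⊆-hat 𝓡 (L ⇝ R) (t , π′ , t∈L , hatR⊆R (π , π∈R , π′∈barπ) , refl)))
  (λ { R⊆P∗•L (_ , (t , π , t∈L , π∈R , refl) , σ∈bar) →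
    -- The instance `π′ = π` puts `t · π` in `P`; as `σ ∈ bar ｛ t · π ｝`, it witnesses `σ ∈ hat P`.
    hatP⊆P (t · π , R⊆P∗•L π∈R t π t∈L (⊆-bar 𝓡 _ refl) , σ∈bar) })
  where open RealizabilityLattice 𝓡
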